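{- For every integer $n\geq 1$, $$F_{3n} = 2T_{n-1}(4) - \sum_{k=1}^{n-2} \bigl(4T_{n-1-k}(4)-2T_{n-2-k}(4)\bigr)F_{3k},$$ $$F_{3n} + 4 F_{3n-3} = 2U_{n-1}(4) -\sum_{k=1}^{n-2}\bigl(4U_{n-1-k}(4)-2U_{n-2-k}(4)\bigr)F_{3k},$$ where, for every integer $n\ge 0$, $$T_{n}(4) = 4^n \sum_{j=0}^{\lfloor n/2\rfloor} \binom{n}{2j}\Bigl(\frac{15}{16}\Bigr)^j \quad\text{and}\quad U_{n}(4) = 4^n \sum_{j=0}^{\lfloor n/2\rfloor} \binom{n+1}{2j+1}\Bigl(\frac{15}{16}\Bigr)^j.$$
   Context: $F_n$ denotes the Fibonacci numbers: $F_0=0$, $F_1=1$, $F_n=F_{n-1}+F_{n-2}$ for $n\geq 2$. The Chebyshev polynomials of the first kind $T_n(x)$ and of the second kind $U_n(x)$ are defined by $T_0(x)=1$, $T_1(x)=x$, $T_{n+1}(x)=2xT_n(x)-T_{n-1}(x)$, and $U_0(x)=1$, $U_1(x)=2x$, $U_{n+1}(x)=2xU_n(x)-U_{n-1}(x)$ for $n\ge 1$; $T_n(4)$, $U_n(4)$ are their values at $x=4$. A sum whose upper limit is smaller than its lower limit is $0$. -}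

module Defs where

open import Algebra.Bundles using (CommutativeRing)
open import Data.Fin using (toℕ)
open import Data.Integer using (+_)
open import Data.Nat as ℕ using (ℕ; zero; suc; _∸_)
open import Data.Rational using (ℚ; 1ℚ; _*_; _-_)
open import Data.Rational.Literals using (fromℤ)
open import Data.Rational.Properties using (+-*-commutativeRing)

open import Algebra.Properties.Semiring.Sum (CommutativeRing.semiring +-*-commutativeRing) using (sum)
open import Algebra.Properties.Semiring.Exp (CommutativeRing.semiring +-*-commutativeRing) public using (_^_)

fromℕ : ℕ → ℚ
fromℕ n = fromℤ (+ n)

-- The sum of f a, f (a + 1), …, f b.  There are suc b ∸ a terms, hence none
-- when b < a.
sumFromTo : ℕ → ℕ → (ℕ → ℚ) → ℚ
sumFromTo a b f = sum {suc b ∸ a} (λ i → f (a ℕ.+ toℕ i))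

syntax sumFromTo a b (λ k → e) = ∑[ k from a to b ] e

F : ℕ → ℕ
F zero          = 0
F (suc zero)    = 1
F (suc (suc n)) = F (suc n) ℕ.+ F n

T : ℕ → ℚ → ℚ
T zero          x = 1ℚ
T (suc zero)    x = x
T (suc (suc n)) x = fromℕ 2 * x * T (suc n) x - T n x

U : ℕ → ℚ → ℚ
U zero          x = 1ℚ
U (suc zero)    x = fromℕ 2 * x
U (suc (suc n)) x = fromℕ 2 * x * U (suc n) x - U n x

{-# OPTIONS --safe #-}

-- Both right-hand sides are values of one convolution.  If p (2 + n) = 8 p (1 + n) - p n
-- and g (2 + k) = 4 g (1 + k) + g k, then
--   4 p (j + 1) - 2 p j = p (j + 2) - 4 p (j + 1) - p j,
-- so the recurrence of g makes the convolution telescope; g k = F (3 k) is such a sequence.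
-- For the closed forms, Pascal's rule gives
--   C(n+2,k+2) + C(n,k+2) = 2 C(n+1,k+2) + C(n,k),
-- uniformly in the parity of k; summed against powers of 15/16 and rescaled by 4ⁿ it becomes
-- the Chebyshev recurrence at 4, because 4² (1 - 15/16) = 1.
module Submission where

open import Defs
open import Algebra.Bundles using (CommutativeRing)
open import Data.Fin using (Fin; toℕ)
open import Data.Integer as ℤ using (+_)
import Data.Integer.Properties as ℤ
open import Data.Nat as ℕ using (ℕ; zero; suc; _∸_; ⌊_/2⌋; s≤s)
open import Data.Nat.Combinatorics using (_C_; nC1≡n; nCk+nC[k+1]≡[n+1]C[k+1])
import Data.Nat.Properties as ℕ
open import Data.Nat.Tactic.RingSolver using (solve-∀)
open import Data.Product using (_×_; _,_)
open import Data.Rational using (ℚ; 0ℚ; 1ℚ; _+_; _*_; _-_; _/_)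
open import Data.Rational.Properties
  using (+-*-commutativeRing; toℚᵘ-injective; toℚᵘ-homo-+; toℚᵘ-homo-*; *-identityˡ; *-identityʳ; +-identityʳ; *-zeroˡ)
open import Data.Rational.Solver using (module +-*-Solver)
open import Data.Rational.Unnormalised using (*≡*)
import Data.Rational.Unnormalised.Properties as ℚᵘ
open import Relation.Binary.PropositionalEquality
  using (_≡_; refl; sym; trans; cong; cong₂; module ≡-Reasoning)

open import Algebra.Properties.Semiring.Sum (CommutativeRing.semiring +-*-commutativeRing)
  using (sum; sum-cong-≗; sum-replicate-zero; ∑-distrib-+; *-distribˡ-sum)
open +-*-Solver using (solve; con; _:+_; _:*_; _:-_; _:=_)
open ≡-Reasoning

-- Addition in `ℚ` normalises by a gcd and does not compute on variables. Among unnormalised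
-- rationals both sides have denominator 1, and cross-multiplication leaves an integer identity.
fromℕ-+ : ∀ m n → fromℕ (m ℕ.+ n) ≡ fromℕ m + fromℕ n
fromℕ-+ m n = toℚᵘ-injective
  (ℚᵘ.≃-trans (*≡* (cong (ℤ._* + 1) (sym (cong₂ ℤ._+_ (ℤ.*-identityʳ (+ m)) (ℤ.*-identityʳ (+ n))))))
              (ℚᵘ.≃-sym (toℚᵘ-homo-+ (fromℕ m) (fromℕ n))))

fromℕ-* : ∀ m n → fromℕ (m ℕ.* n) ≡ fromℕ m * fromℕ n
fromℕ-* m n = toℚᵘ-injective
  (ℚᵘ.≃-trans (*≡* (cong (ℤ._* + 1) (ℤ.pos-* m n)))
              (ℚᵘ.≃-sym (toℚᵘ-homo-* (fromℕ m) (fromℕ n))))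

-- Telescoping convolutions and the sequence F(3k)

-- Induction on `m` for all `g` at once: splitting off the summand `k = 1` leaves the same claim for
-- the shifted sequence `g (suc k)`, which obeys the same recurrence.
convolution-telescopes : (p : ℕ → ℚ) → (∀ n → p (2 ℕ.+ n) ≡ fromℕ 8 * p (1 ℕ.+ n) - p n) →
  (g : ℕ → ℚ) → (∀ k → g (2 ℕ.+ k) ≡ fromℕ 4 * g (1 ℕ.+ k) + g k) → ∀ m →
  p (1 ℕ.+ m) * g 1 + p m * g 0
    - (∑[ k from 1 to m ] ((fromℕ 4 * p (suc m ∸ k) - fromℕ 2 * p (m ∸ k)) * g k))
  ≡ p 1 * g (1 ℕ.+ m) + p 0 * g m
convolution-telescopes p p-rec g g-rec zero =
  solve 1 (λ a → a :- con 0ℚ := a) refl (p 1 * g 1 + p 0 * g 0)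
convolution-telescopes p p-rec g g-rec (suc m) = begin
  p (2 ℕ.+ m) * g 1 + p (1 ℕ.+ m) * g 0 - (d + s)
    ≡⟨ cong (λ a → a * g 1 + p (1 ℕ.+ m) * g 0 - (d + s)) (p-rec m) ⟩
  (fromℕ 8 * p (1 ℕ.+ m) - p m) * g 1 + p (1 ℕ.+ m) * g 0 - (d + s)
    -- The coefficient of `g 1` becomes (8a - b) - (4a - 2b) = 4a + b; its 4a joins a `g 0` to form
    -- a `g 2`.
    ≡⟨ solve 5 (λ a b x y s →
         (con (fromℕ 8) :* a :- b) :* y :+ a :* x :- ((con (fromℕ 4) :* a :- con (fromℕ 2) :* b) :* y :+ s)
         := a :* (con (fromℕ 4) :* y :+ x) :+ b :* y :- s) refl (p (1 ℕ.+ m)) (p m) (g 0) (g 1) s ⟩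
  p (1 ℕ.+ m) * (fromℕ 4 * g 1 + g 0) + p m * g 1 - s
    ≡⟨ cong (λ a → p (1 ℕ.+ m) * a + p m * g 1 - s) (g-rec 0) ⟨
  p (1 ℕ.+ m) * g 2 + p m * g 1 - s
    ≡⟨ convolution-telescopes p p-rec (λ k → g (suc k)) (λ k → g-rec (suc k)) m ⟩
  p 1 * g (2 ℕ.+ m) + p 0 * g (1 ℕ.+ m) ∎
  where
  d s : ℚ
  d = (fromℕ 4 * p (1 ℕ.+ m) - fromℕ 2 * p m) * g 1
  -- Passing from `k` to `suc k` removes one successor from each side of `∸`, so this is
  -- definitionally the tail of the sum up to `suc m`.
  s = ∑[ k from 1 to m ] ((fromℕ 4 * p (suc m ∸ k) - fromℕ 2 * p (m ∸ k)) * g (suc k))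

F3 : ℕ → ℚ
F3 k = fromℕ (F (3 ℕ.* k))

-- In terms of `x = F (suc n)` and `y = F n`, both sides are 8x + 5y.
F-+6 : ∀ n → F (6 ℕ.+ n) ≡ 4 ℕ.* F (3 ℕ.+ n) ℕ.+ F n
F-+6 n = identity (F (suc n)) (F n)
  where
  identity : ∀ x y → let x₂ = x ℕ.+ y; x₃ = x₂ ℕ.+ x; x₄ = x₃ ℕ.+ x₂; x₅ = x₄ ℕ.+ x₃ in
    x₅ ℕ.+ x₄ ≡ 4 ℕ.* x₃ ℕ.+ y
  identity = solve-∀

F3-rec : ∀ k → F3 (2 ℕ.+ k) ≡ fromℕ 4 * F3 (1 ℕ.+ k) + F3 k
F3-rec k = begin
  fromℕ (F (3 ℕ.* (2 ℕ.+ k)))   ≡⟨ cong (λ i → fromℕ (F i)) (ℕ.*-distribˡ-+ 3 2 k) ⟩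
  fromℕ (F (6 ℕ.+ 3 ℕ.* k))     ≡⟨ cong fromℕ (F-+6 (3 ℕ.* k)) ⟩
  fromℕ (4 ℕ.* x ℕ.+ y)         ≡⟨ fromℕ-+ (4 ℕ.* x) y ⟩
  fromℕ (4 ℕ.* x) + F3 k        ≡⟨ cong (_+ F3 k) (fromℕ-* 4 x) ⟩
  fromℕ 4 * fromℕ x + F3 k      ≡⟨ cong (λ i → fromℕ 4 * fromℕ (F i) + F3 k) (ℕ.*-distribˡ-+ 3 1 k) ⟨
  fromℕ 4 * F3 (1 ℕ.+ k) + F3 k ∎
  where
  x y : ℕ
  x = F (3 ℕ.+ 3 ℕ.* k)
  y = F (3 ℕ.* k)

-- The boundary values `F3 1 = 2` and `F3 0 = 0` leave only `fromℕ 2 * p (1 + m)` outside the sum.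
F3-convolution : (p : ℕ → ℚ) → (∀ n → p (2 ℕ.+ n) ≡ fromℕ 8 * p (1 ℕ.+ n) - p n) → ∀ m →
  fromℕ 2 * p (1 ℕ.+ m)
    - (∑[ k from 1 to m ] ((fromℕ 4 * p (suc m ∸ k) - fromℕ 2 * p (m ∸ k)) * F3 k))
  ≡ p 1 * F3 (1 ℕ.+ m) + p 0 * F3 m
F3-convolution p p-rec m = trans
  (solve 3 (λ a b s → con (fromℕ 2) :* a :- s := a :* con (fromℕ 2) :+ b :* con 0ℚ :- s) refl
    (p (1 ℕ.+ m)) (p m) _)
  (convolution-telescopes p p-rec F3 F3-rec m)

-- Binomial sums and the closed forms

-- Pascal's rule expands everything in C(n,k), C(n,k+1) and C(n,k+2). The separate index `l` admits
-- arguments such as `2 * suc j`, which equal `2 + k` only propositionally.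
C-second-difference : ∀ n k {l} → l ≡ 2 ℕ.+ k →
  (2 ℕ.+ n) C l ℕ.+ n C l ≡ 2 ℕ.* ((1 ℕ.+ n) C l) ℕ.+ n C k
C-second-difference n k refl
  rewrite sym (nCk+nC[k+1]≡[n+1]C[k+1] (suc n) (suc k))
        | sym (nCk+nC[k+1]≡[n+1]C[k+1] n (suc k))
        | sym (nCk+nC[k+1]≡[n+1]C[k+1] n k)
  = identity (n C k) (n C suc k) (n C suc (suc k))
  where
  identity : ∀ x y z → x ℕ.+ y ℕ.+ (y ℕ.+ z) ℕ.+ z ≡ 2 ℕ.* (y ℕ.+ z) ℕ.+ x
  identity = solve-∀

-- The triangle `a` stands for both C(n,2j) and C(n+1,2j+1). The case `j = 0` is a separate
-- hypothesis because the term with index j - 1 is absent there.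
module _
  (a : ℕ → ℕ → ℕ)
  (a-zero : ∀ n → a (2 ℕ.+ n) 0 ℕ.+ a n 0 ≡ 2 ℕ.* a (1 ℕ.+ n) 0)
  (a-suc : ∀ n j → a (2 ℕ.+ n) (suc j) ℕ.+ a n (suc j)
                 ≡ 2 ℕ.* a (1 ℕ.+ n) (suc j) ℕ.+ a n j)
  (r : ℚ)
  where

  term : ℕ → ℕ → ℚ
  term n j = fromℕ (a n j) * r ^ j

  partialSum : ℕ → ℕ → ℚ
  partialSum N n = sum {N} (λ i → term n (toℕ i))

  term-zero : ∀ n → term (2 ℕ.+ n) 0 + term n 0 ≡ fromℕ 2 * term (1 ℕ.+ n) 0
  term-zero n = begin
    fromℕ (a (2 ℕ.+ n) 0) * 1ℚ + fromℕ (a n 0) * 1ℚ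
      ≡⟨ cong₂ _+_ (*-identityʳ (fromℕ (a (2 ℕ.+ n) 0))) (*-identityʳ (fromℕ (a n 0))) ⟩
    fromℕ (a (2 ℕ.+ n) 0) + fromℕ (a n 0)
      ≡⟨ fromℕ-+ (a (2 ℕ.+ n) 0) (a n 0) ⟨
    fromℕ (a (2 ℕ.+ n) 0 ℕ.+ a n 0)
      ≡⟨ cong fromℕ (a-zero n) ⟩
    fromℕ (2 ℕ.* a (1 ℕ.+ n) 0)
      ≡⟨ fromℕ-* 2 (a (1 ℕ.+ n) 0) ⟩
    fromℕ 2 * fromℕ (a (1 ℕ.+ n) 0)
      ≡⟨ cong (fromℕ 2 *_) (*-identityʳ (fromℕ (a (1 ℕ.+ n) 0))) ⟨
    fromℕ 2 * (fromℕ (a (1 ℕ.+ n) 0) * 1ℚ) ∎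

  term-suc : ∀ n j → term (2 ℕ.+ n) (suc j) + term n (suc j)
                   ≡ fromℕ 2 * term (1 ℕ.+ n) (suc j) + r * term n j
  term-suc n j = begin
    fromℕ x * (r * r ^ j) + fromℕ z * (r * r ^ j)
      ≡⟨ solve 3 (λ x z q → x :* q :+ z :* q := (x :+ z) :* q) refl (fromℕ x) (fromℕ z) (r * r ^ j) ⟩
    (fromℕ x + fromℕ z) * (r * r ^ j)
      ≡⟨ cong (_* (r * r ^ j)) sums ⟩
    (fromℕ 2 * fromℕ y + fromℕ w) * (r * r ^ j)
      ≡⟨ solve 4 (λ y w r q → (con (fromℕ 2) :* y :+ w) :* (r :* q)
           := con (fromℕ 2) :* (y :* (r :* q)) :+ r :* (w :* q)) refl (fromℕ y) (fromℕ w) r (r ^ j) ⟩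
    fromℕ 2 * (fromℕ y * (r * r ^ j)) + r * (fromℕ w * r ^ j) ∎
    where
    x y z w : ℕ
    x = a (2 ℕ.+ n) (suc j)
    y = a (1 ℕ.+ n) (suc j)
    z = a n (suc j)
    w = a n j
    sums : fromℕ x + fromℕ z ≡ fromℕ 2 * fromℕ y + fromℕ w
    sums = begin
      fromℕ x + fromℕ z             ≡⟨ fromℕ-+ x z ⟨
      fromℕ (x ℕ.+ z)               ≡⟨ cong fromℕ (a-suc n j) ⟩
      fromℕ (2 ℕ.* y ℕ.+ w)         ≡⟨ fromℕ-+ (2 ℕ.* y) w ⟩
      fromℕ (2 ℕ.* y) + fromℕ w     ≡⟨ cong (_+ fromℕ w) (fromℕ-* 2 y) ⟩
      fromℕ 2 * fromℕ y + fromℕ w   ∎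

  -- Lowering `j` by one releases a factor `r` and drops one term, hence `partialSum N n` at the
  -- end.
  partialSum-rec : ∀ N n → partialSum (suc N) (2 ℕ.+ n) + partialSum (suc N) n
                         ≡ fromℕ 2 * partialSum (suc N) (1 ℕ.+ n) + r * partialSum N n
  partialSum-rec N n = begin
    (term (2 ℕ.+ n) 0 + sum f₂) + (term n 0 + sum f₀)
      ≡⟨ solve 4 (λ a b c d → (a :+ b) :+ (c :+ d) := (a :+ c) :+ (b :+ d)) refl
           (term (2 ℕ.+ n) 0) (sum f₂) (term n 0) (sum f₀) ⟩
    (term (2 ℕ.+ n) 0 + term n 0) + (sum f₂ + sum f₀)
      ≡⟨ cong₂ _+_ (term-zero n) tails ⟩
    fromℕ 2 * term (1 ℕ.+ n) 0 + (fromℕ 2 * sum f₁ + r * sum g)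
      ≡⟨ solve 3 (λ t u v → con (fromℕ 2) :* t :+ (con (fromℕ 2) :* u :+ v)
           := con (fromℕ 2) :* (t :+ u) :+ v) refl (term (1 ℕ.+ n) 0) (sum f₁) (r * sum g) ⟩
    fromℕ 2 * (term (1 ℕ.+ n) 0 + sum f₁) + r * sum g ∎
    where
    f₀ f₁ f₂ g : Fin N → ℚ
    f₀ i = term n (suc (toℕ i))
    f₁ i = term (1 ℕ.+ n) (suc (toℕ i))
    f₂ i = term (2 ℕ.+ n) (suc (toℕ i))
    g i = term n (toℕ i)
    tails : sum f₂ + sum f₀ ≡ fromℕ 2 * sum f₁ + r * sum g
    tails = begin
      sum f₂ + sum f₀                                         ≡⟨ ∑-distrib-+ f₂ f₀ ⟨
      sum (λ i → f₂ i + f₀ i)                                 ≡⟨ sum-cong-≗ {N} (λ i → term-suc n (toℕ i)) ⟩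
      sum (λ i → fromℕ 2 * f₁ i + r * g i)                    ≡⟨ ∑-distrib-+ (λ i → fromℕ 2 * f₁ i) (λ i → r * g i) ⟩
      sum (λ i → fromℕ 2 * f₁ i) + sum (λ i → r * g i)
        ≡⟨ cong₂ _+_ (*-distribˡ-sum (fromℕ 2) f₁) (*-distribˡ-sum r g) ⟨
      fromℕ 2 * sum f₁ + r * sum g                            ∎

  partialSum-vanishing : ∀ N n → (∀ j → a n (suc j) ≡ 0) → partialSum (suc N) n ≡ fromℕ (a n 0)
  partialSum-vanishing N n a≡0 = begin
    term n 0 + sum {N} (λ i → term n (suc (toℕ i)))
      ≡⟨ cong (λ s → term n 0 + s) (sum-cong-≗ {N} (λ i →
           trans (cong (λ b → fromℕ b * r ^ suc (toℕ i)) (a≡0 (toℕ i))) (*-zeroˡ (r ^ suc (toℕ i))))) ⟩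
    term n 0 + sum {N} (λ _ → 0ℚ)
      ≡⟨ cong (λ s → term n 0 + s) (sum-replicate-zero N) ⟩
    fromℕ (a n 0) * 1ℚ + 0ℚ
      ≡⟨ trans (+-identityʳ (term n 0)) (*-identityʳ (fromℕ (a n 0))) ⟩
    fromℕ (a n 0) ∎

  -- The bound N is left free because p (2 + n) with bound suc N needs p n both with
  -- bound suc N and with bound N.
  closed-form : (∀ j → a 0 (suc j) ≡ 0) → (∀ j → a 1 (suc j) ≡ 0) →
    (x : ℚ) → x * x * (1ℚ - r) ≡ 1ℚ →
    (p : ℕ → ℚ) → p 0 ≡ fromℕ (a 0 0) → p 1 ≡ x * fromℕ (a 1 0) →
    (∀ n → p (2 ℕ.+ n) ≡ fromℕ 2 * x * p (1 ℕ.+ n) - p n) →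
    ∀ n N → ⌊ n /2⌋ ℕ.< N → p n ≡ x ^ n * partialSum N n
  closed-form a₀≡0 a₁≡0 x x²[1-r]≡1 p p₀ p₁ p-rec = go
    where
    go : ∀ n N → ⌊ n /2⌋ ℕ.< N → p n ≡ x ^ n * partialSum N n
    go zero (suc N) _ = trans p₀ (sym (trans
      (*-identityˡ (partialSum (suc N) 0)) (partialSum-vanishing N 0 a₀≡0)))
    go (suc zero) (suc N) _ = trans p₁ (sym
      (cong₂ _*_ (*-identityʳ x) (partialSum-vanishing N 1 a₁≡0)))
    go (suc (suc n)) (suc N) (s≤s n/2<N) = begin
      p (2 ℕ.+ n)
        ≡⟨ p-rec n ⟩
      fromℕ 2 * x * p (1 ℕ.+ n) - p n
        ≡⟨ solve 3 (λ x u v → con (fromℕ 2) :* x :* u :- v := con (fromℕ 2) :* x :* u :- con 1ℚ :* v) refl x _ _ ⟩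
      fromℕ 2 * x * p (1 ℕ.+ n) - 1ℚ * p n
        -- Replacing 1 by x²(1 - r) raises the coefficient of `p n` to degree two in `x`, so that
        -- x^(n+2) can be factored out.
        ≡⟨ cong (λ e → fromℕ 2 * x * p (1 ℕ.+ n) - e * p n) x²[1-r]≡1 ⟨
      fromℕ 2 * x * p (1 ℕ.+ n) - x * x * (1ℚ - r) * p n
        ≡⟨ solve 4 (λ x r u v → con (fromℕ 2) :* x :* u :- x :* x :* (con 1ℚ :- r) :* v
             := con (fromℕ 2) :* x :* u :+ x :* x :* (r :* v :- v)) refl x r _ _ ⟩
      fromℕ 2 * x * p (1 ℕ.+ n) + x * x * (r * p n - p n)
        ≡⟨ cong₂ (λ u v → fromℕ 2 * x * u + x * x * v)
             -- `suc N` terms suffice for `suc n`, since its half is at most `suc ⌊ n /2⌋`, which is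
             -- at most `N`.
             (go (suc n) (suc N) (s≤s (ℕ.≤-trans (ℕ.⌊n/2⌋-mono (ℕ.n≤1+n (suc n))) n/2<N)))
             (cong₂ (λ v w → r * v - w) (go n N n/2<N) (go n (suc N) (ℕ.m≤n⇒m≤1+n n/2<N))) ⟩
      fromℕ 2 * x * (x * x ^ n * s₁) + x * x * (r * (x ^ n * t₀) - x ^ n * s₀)
        ≡⟨ solve 6 (λ x r q s₁ t₀ s₀ →
             con (fromℕ 2) :* x :* (x :* q :* s₁) :+ x :* x :* (r :* (q :* t₀) :- q :* s₀)
             := x :* (x :* q) :* (con (fromℕ 2) :* s₁ :+ r :* t₀ :- s₀)) refl x r (x ^ n) s₁ t₀ s₀ ⟩
      x * (x * x ^ n) * (fromℕ 2 * s₁ + r * t₀ - s₀)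
        ≡⟨ cong (λ e → x * (x * x ^ n) * (e - s₀)) (partialSum-rec N n) ⟨
      x * (x * x ^ n) * (s₂ + s₀ - s₀)
        ≡⟨ cong (x * (x * x ^ n) *_) (solve 2 (λ s t → s :+ t :- t := s) refl s₂ s₀) ⟩
      x * (x * x ^ n) * s₂ ∎
      where
      s₀ s₁ s₂ t₀ : ℚ
      s₀ = partialSum (suc N) n
      s₁ = partialSum (suc N) (1 ℕ.+ n)
      s₂ = partialSum (suc N) (2 ℕ.+ n)
      t₀ = partialSum N n

T-closed-form : ∀ n → T n (fromℕ 4)
  ≡ fromℕ 4 ^ n * (∑[ j from 0 to ⌊ n /2⌋ ] (fromℕ (n C (2 ℕ.* j)) * (+ 15 / 16) ^ j))
T-closed-form n = closed-form (λ n j → n C (2 ℕ.* j)) (λ _ → refl) second-difference (+ 15 / 16)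
  vanishing₀ vanishing₁ (fromℕ 4) refl (λ n → T n (fromℕ 4)) refl refl (λ _ → refl)
  -- The bound counts terms, so it is one more than the upper limit of the sum.
  n (suc ⌊ n /2⌋) ℕ.≤-refl
  where
  second-difference : ∀ n j → (2 ℕ.+ n) C (2 ℕ.* suc j) ℕ.+ n C (2 ℕ.* suc j)
    ≡ 2 ℕ.* ((1 ℕ.+ n) C (2 ℕ.* suc j)) ℕ.+ n C (2 ℕ.* j)
  second-difference n j = C-second-difference n (2 ℕ.* j) (ℕ.*-suc 2 j)
  vanishing₀ : ∀ j → 0 C (2 ℕ.* suc j) ≡ 0
  vanishing₀ j = cong (0 C_) (ℕ.*-suc 2 j)
  vanishing₁ : ∀ j → 1 C (2 ℕ.* suc j) ≡ 0
  vanishing₁ j = cong (1 C_) (ℕ.*-suc 2 j)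

U-closed-form : ∀ n → U n (fromℕ 4)
  ≡ fromℕ 4 ^ n * (∑[ j from 0 to ⌊ n /2⌋ ] (fromℕ ((n ℕ.+ 1) C (2 ℕ.* j ℕ.+ 1)) * (+ 15 / 16) ^ j))
U-closed-form n = closed-form (λ n j → (n ℕ.+ 1) C (2 ℕ.* j ℕ.+ 1)) second-difference₀ second-difference
  (+ 15 / 16) vanishing₀ vanishing₁ (fromℕ 4) refl (λ n → U n (fromℕ 4)) refl refl (λ _ → refl)
  n (suc ⌊ n /2⌋) ℕ.≤-refl
  where
  second-difference₀ : ∀ n → (2 ℕ.+ n ℕ.+ 1) C 1 ℕ.+ (n ℕ.+ 1) C 1
    ≡ 2 ℕ.* ((1 ℕ.+ n ℕ.+ 1) C 1)
  -- C(m,1) = m, so the claim is that n + 1, n + 2, n + 3 is an arithmetic progression.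
  second-difference₀ n rewrite nC1≡n (2 ℕ.+ n ℕ.+ 1) | nC1≡n (1 ℕ.+ n ℕ.+ 1) | nC1≡n (n ℕ.+ 1) =
    identity n
    where
    identity : ∀ n → 2 ℕ.+ n ℕ.+ 1 ℕ.+ (n ℕ.+ 1) ≡ 2 ℕ.* (1 ℕ.+ n ℕ.+ 1)
    identity = solve-∀
  second-difference : ∀ n j → (2 ℕ.+ n ℕ.+ 1) C (2 ℕ.* suc j ℕ.+ 1) ℕ.+ (n ℕ.+ 1) C (2 ℕ.* suc j ℕ.+ 1)
    ≡ 2 ℕ.* ((1 ℕ.+ n ℕ.+ 1) C (2 ℕ.* suc j ℕ.+ 1)) ℕ.+ (n ℕ.+ 1) C (2 ℕ.* j ℕ.+ 1)
  second-difference n j =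
    C-second-difference (n ℕ.+ 1) (2 ℕ.* j ℕ.+ 1) (cong (ℕ._+ 1) (ℕ.*-suc 2 j))
  vanishing₀ : ∀ j → 1 C (2 ℕ.* suc j ℕ.+ 1) ≡ 0
  vanishing₀ j = cong (λ l → 1 C (l ℕ.+ 1)) (ℕ.*-suc 2 j)
  vanishing₁ : ∀ j → 2 C (2 ℕ.* suc j ℕ.+ 1) ≡ 0
  -- Three explicit successors in the lower index are needed before `2 C_` computes to 0.
  vanishing₁ j = cong (2 C_) (3+2j j)
    where
    3+2j : ∀ j → 2 ℕ.* suc j ℕ.+ 1 ≡ 3 ℕ.+ 2 ℕ.* j
    3+2j = solve-∀

-- The two convolution identities

T-convolution : ∀ n → 1 ℕ.≤ n → fromℕ (F (3 ℕ.* n))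
  ≡ fromℕ 2 * T (n ∸ 1) (fromℕ 4)
    - (∑[ k from 1 to n ∸ 2 ] ((fromℕ 4 * T (n ∸ 1 ∸ k) (fromℕ 4) - fromℕ 2 * T (n ∸ 2 ∸ k) (fromℕ 4)) * fromℕ (F (3 ℕ.* k))))
-- Here `1 ∸ 2` is 0, so the sum is empty and both sides are 2.
T-convolution (suc zero) _ = refl
T-convolution (suc (suc m)) _ = begin
  F3 (2 ℕ.+ m)
    ≡⟨ F3-rec m ⟩
  fromℕ 4 * F3 (1 ℕ.+ m) + F3 m
    -- The coefficients 4 and 1 of the recurrence are T₁(4) and T₀(4).
    ≡⟨ solve 2 (λ x y → con (fromℕ 4) :* x :+ y := con (fromℕ 4) :* x :+ con 1ℚ :* y) refl (F3 (1 ℕ.+ m)) (F3 m) ⟩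
  fromℕ 4 * F3 (1 ℕ.+ m) + 1ℚ * F3 m
    ≡⟨ F3-convolution (λ n → T n (fromℕ 4)) (λ _ → refl) m ⟨
  _ ∎

U-convolution : ∀ n → 1 ℕ.≤ n → fromℕ (F (3 ℕ.* n)) + fromℕ 4 * fromℕ (F (3 ℕ.* n ∸ 3))
  ≡ fromℕ 2 * U (n ∸ 1) (fromℕ 4)
    - (∑[ k from 1 to n ∸ 2 ] ((fromℕ 4 * U (n ∸ 1 ∸ k) (fromℕ 4) - fromℕ 2 * U (n ∸ 2 ∸ k) (fromℕ 4)) * fromℕ (F (3 ℕ.* k))))
U-convolution (suc zero) _ = refl
U-convolution (suc (suc m)) _ = begin
  F3 (2 ℕ.+ m) + fromℕ 4 * fromℕ (F (3 ℕ.* (2 ℕ.+ m) ∸ 3))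
    ≡⟨ cong₂ (λ u i → u + fromℕ 4 * fromℕ (F i)) (F3-rec m)
         (cong (_∸ 3) (ℕ.*-suc 3 (suc m))) ⟩
  fromℕ 4 * F3 (1 ℕ.+ m) + F3 m + fromℕ 4 * F3 (1 ℕ.+ m)
    -- The extra 4F(3n-3) turns the coefficient 4 into 8 = U₁(4), beside U₀(4) = 1.
    ≡⟨ solve 2 (λ x y → con (fromℕ 4) :* x :+ y :+ con (fromℕ 4) :* x := con (fromℕ 8) :* x :+ con 1ℚ :* y) refl
         (F3 (1 ℕ.+ m)) (F3 m) ⟩
  fromℕ 8 * F3 (1 ℕ.+ m) + 1ℚ * F3 m
    ≡⟨ F3-convolution (λ n → U n (fromℕ 4)) (λ _ → refl) m ⟨
  _ ∎

corollary11 : (∀ (n : ℕ) → 1 ℕ.≤ n →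
    (fromℕ (F (3 ℕ.* n))
    ≡ fromℕ 2 * T (n ∸ 1) (fromℕ 4)
    - (∑[ k from 1 to n ∸ 2 ] ((fromℕ 4 * T (n ∸ 1 ∸ k) (fromℕ 4) - fromℕ 2 * T (n ∸ 2 ∸ k) (fromℕ 4)) * fromℕ (F (3 ℕ.* k)))))
    ×
    (fromℕ (F (3 ℕ.* n)) + fromℕ 4 * fromℕ (F (3 ℕ.* n ∸ 3))
    ≡ fromℕ 2 * U (n ∸ 1) (fromℕ 4)
    - (∑[ k from 1 to n ∸ 2 ] ((fromℕ 4 * U (n ∸ 1 ∸ k) (fromℕ 4) - fromℕ 2 * U (n ∸ 2 ∸ k) (fromℕ 4)) * fromℕ (F (3 ℕ.* k))))))
    ×
    (∀ (n : ℕ) →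
    (T n (fromℕ 4)
    ≡ fromℕ 4 ^ n * (∑[ j from 0 to ⌊ n /2⌋ ] (fromℕ (n C (2 ℕ.* j)) * (+ 15 / 16) ^ j)))
    ×
    (U n (fromℕ 4)
    ≡ fromℕ 4 ^ n * (∑[ j from 0 to ⌊ n /2⌋ ] (fromℕ ((n ℕ.+ 1) C (2 ℕ.* j ℕ.+ 1)) * (+ 15 / 16) ^ j))))
corollary11 = (λ n 1≤n → T-convolution n 1≤n , U-convolution n 1≤n)
            , (λ n → T-closed-form n , U-closed-form n)
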